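{- Let $\mathcal{Q}$ be a small quantaloid. For any $\mathcal{Q}$-distributor $\phi:\mathbb{A}\nrightarrow\mathbb{B}$ between $\mathcal{Q}$-categories, a separated complete $\mathcal{Q}$-category $\mathbb{X}$ is isomorphic to $\mathsf{K}\phi$ if, and only if, there exist a $\bigvee$-dense type-preserving map $F:\mathbb{B}_0\times_{\mathrm{dom}}\mathcal{Q}_1\to\mathbb{X}_0$ and a $\bigwedge$-dense type-preserving map $G:\mathbb{A}_0\times_{\mathrm{dom}}\mathcal{Q}_1\to\mathbb{X}_0$ such that $$(u\swarrow\phi(a,b))\swarrow v=\mathbb{X}(F(b,v),G(a,u))$$ for all $(a,u)\in\mathbb{A}_0\times_{\mathrm{dom}}\mathcal{Q}_1$, $(b,v)\in\mathbb{B}_0\times_{\mathrm{dom}}\mathcal{Q}_1$.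
   Context: A quantaloid $\mathcal{Q}$ is a category whose hom-sets are complete lattices and whose composition $\circ$ preserves joins in each variable; small means it has a set $\mathcal{Q}_0$ of objects and a set $\mathcal{Q}_1$ of arrows; $1_q$ denotes identities. For $u:p\to q$, $w:p\to r$, the left implication $w\swarrow u:q\to r$ is determined by $v\circ u\leq w\iff v\leq w\swarrow u$ for all $v:q\to r$. A $\mathcal{Q}$-typed set is a set $A$ with a map $|\cdot|:A\to\mathcal{Q}_0$; maps preserving types are type-preserving. A $\mathcal{Q}$-category $\mathbb{A}$ is a $\mathcal{Q}$-typed set $\mathbb{A}_0$ with arrows $\mathbb{A}(x,y)\in\mathcal{Q}(|x|,|y|)$ such that $1_{|x|}\leq\mathbb{A}(x,x)$ and $\mathbb{A}(y,z)\circ\mathbb{A}(x,y)\leq\mathbb{A}(x,z)$. A $\mathcal{Q}$-subcategory is a subset of objects with the same hom-arrows. The underlying preorder: $x\leq y$ iff $|x|=|y|$ and $1_{|x|}\leq\mathbb{A}(x,y)$; $x\cong y$ means $x\leq y$ and $y\leq x$; $\mathbb{A}$ is separated if $x\cong y$ implies $x=y$. A $\mathcal{Q}$-functor $F:\mathbb{A}\to\mathbb{B}$ is a type-preserving map $\mathbb{A}_0\to\mathbb{B}_0$ with $\mathbb{A}(x,x')\leq\mathbb{B}(Fx,Fx')$; an isomorphism is a $\mathcal{Q}$-functor with a two-sided inverse $\mathcal{Q}$-functor. A $\mathcal{Q}$-distributor $\phi:\mathbb{A}\nrightarrow\mathbb{B}$ is a family of arrows $\phi(x,y):|x|\to|y|$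 with $\mathbb{B}(y,y')\circ\phi(x,y)\circ\mathbb{A}(x',x)\leq\phi(x',y')$. For $\phi:\mathbb{A}\nrightarrow\mathbb{B}$, $\psi:\mathbb{B}\nrightarrow\mathbb{C}$, $\xi:\mathbb{A}\nrightarrow\mathbb{C}$: $(\psi\circ\phi)(x,z)=\bigvee_{y}\psi(y,z)\circ\phi(x,y)$, $(\xi\swarrow\phi)(y,z)=\bigwedge_{x}\xi(x,z)\swarrow\phi(x,y)$. $\{q\}$ is the $\mathcal{Q}$-category with one object of type $q$ and hom-arrow $1_q$. $\mathsf{P}\mathbb{A}$ is the $\mathcal{Q}$-category of presheaves $\mu:\mathbb{A}\nrightarrow\{q\}$ (of type $q$) with $\mathsf{P}\mathbb{A}(\mu,\mu')=\mu'\swarrow\mu$. $\mathbb{A}$ is complete if every $\mu\in\mathsf{P}\mathbb{A}$ has a supremum, i.e. an object $\sup\mu$ of type $|\mu|$ with $\mathbb{A}(\sup\mu,-)=\mathbb{A}\swarrow\mu$. For $\phi:\mathbb{A}\nrightarrow\mathbb{B}$: $\phi^*:\mathsf{P}\mathbb{B}\to\mathsf{P}\mathbb{A}$, $\phi^*\lambda=\lambda\circ\phi$, and $\phi_*:\mathsf{P}\mathbb{A}\to\mathsf{P}\mathbb{B}$, $\phi_*\mu=\mu\swarrow\phi$; $\mathsf{K}\phi$ is the $\mathcal{Q}$-subcategory of $\mathsf{P}\mathbb{B}$ of all $\lambda$ with $\phi_*\phi^*\lambda=\lambda$. $\mathbb{A}_0\times_{\mathrm{dom}}\mathcal{Q}_1$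 is the $\mathcal{Q}$-typed set of pairs $(a,u)$ with $a\in\mathbb{A}_0$ and $u$ a $\mathcal{Q}$-arrow with domain $|a|$, with type $|(a,u)|=\mathrm{cod}\,u$ (and similarly for $\mathbb{B}$). A type-preserving map $F:A\to\mathbb{X}_0$ from a $\mathcal{Q}$-typed set is $\bigvee$-dense (resp. $\bigwedge$-dense) if for every $y\in\mathbb{X}_0$ there is a family $\{x_i\}_{i\in I}\subseteq A$ with $y\cong\bigvee_{i\in I}Fx_i$ (resp. $y\cong\bigwedge_{i\in I}Fx_i$) in the underlying preorder of $\mathbb{X}$; here objects of different types are incomparable, and joins and meets (including those of empty families) are taken among objects of the type of $y$. -}

module Defs where

open import Level using (Level; Lift; lift; suc; _⊔_)
open import Data.Bool.Base using (Bool; true; false; if_then_else_)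
open import Data.Product.Base using (Σ; Σ-syntax; _×_; _,_; proj₁; proj₂)
open import Function.Bundles using (Func; _⇔_; mk⇔; module Equivalence)
open import Relation.Binary.Core using (Rel)
open import Relation.Binary.Bundles using (Setoid; Poset)
open import Relation.Binary.PropositionalEquality using (_≡_; refl; setoid)
import Relation.Binary.Reasoning.PartialOrder as PosetReasoning

-- Equality is setoid equality throughout: arrows are compared by the equality
-- of the hom-posets, objects by the equality of the typed set they live in.
-- All families of which joins or meets are taken are indexed by types in the
-- same universe ℓ as the objects and arrows, i.e. by "sets".

module _ {a r i} {A : Set a} (_≤_ : Rel A r) {I : Set i} (x : I → A) where

  IsJoin : A → Set (a ⊔ r ⊔ i)
  IsJoin s = (∀ i → x i ≤ s) × (∀ {z} → (∀ i → x i ≤ z) → s ≤ z)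

  IsMeet : A → Set (a ⊔ r ⊔ i)
  IsMeet s = (∀ i → s ≤ x i) × (∀ {z} → (∀ i → z ≤ x i) → z ≤ s)

record CompleteLattice (ℓ : Level) : Set (suc ℓ) where
  field
    poset : Poset ℓ ℓ ℓ
  open Poset poset public
  field
    ⋁        : {I : Set ℓ} → (I → Carrier) → Carrier
    ⋁-isJoin : {I : Set ℓ} (x : I → Carrier) → IsJoin _≤_ x (⋁ x)

  ⋀ : {I : Set ℓ} → (I → Carrier) → Carrier
  ⋀ x = ⋁ {Σ[ l ∈ Carrier ] (∀ i → l ≤ x i)} proj₁

  ⋀-isMeet : {I : Set ℓ} (x : I → Carrier) → IsMeet _≤_ x (⋀ x)
  ⋀-isMeet x = (λ i → proj₂ (⋁-isJoin _) (λ l → proj₂ l i))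
             , (λ {z} z≤x → proj₁ (⋁-isJoin _) (z , z≤x))

record Quantaloid (ℓ : Level) : Set (suc ℓ) where
  infixr 9 _∘_
  infixl 8 _↙_
  field
    Q₀      : Set ℓ
    lattice : Q₀ → Q₀ → CompleteLattice ℓ

  module L {p} {q} = CompleteLattice (lattice p q)
  open L public using (_≤_; _≈_; ⋁; ⋁-isJoin; ⋀; ⋀-isMeet)

  Q₁ : Q₀ → Q₀ → Set ℓ
  Q₁ p q = L.Carrier {p} {q}

  field
    𝟙         : (q : Q₀) → Q₁ q q
    _∘_       : ∀ {p q r} → Q₁ q r → Q₁ p q → Q₁ p r
    ∘-cong    : ∀ {p q r} {v v′ : Q₁ q r} {u u′ : Q₁ p q} →
                v ≈ v′ → u ≈ u′ → v ∘ u ≈ v′ ∘ u′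
    identityˡ : ∀ {p q} (u : Q₁ p q) → 𝟙 q ∘ u ≈ u
    identityʳ : ∀ {p q} (u : Q₁ p q) → u ∘ 𝟙 p ≈ u
    assoc     : ∀ {p q r s} (w : Q₁ r s) (v : Q₁ q r) (u : Q₁ p q) →
                (w ∘ v) ∘ u ≈ w ∘ (v ∘ u)
    ∘-⋁ˡ      : ∀ {p q r} {I : Set ℓ} (v : I → Q₁ q r) (u : Q₁ p q) →
                ⋁ v ∘ u ≈ ⋁ (λ i → v i ∘ u)
    ∘-⋁ʳ      : ∀ {p q r} {I : Set ℓ} (v : Q₁ q r) (u : I → Q₁ p q) →
                v ∘ ⋁ u ≈ ⋁ (λ i → v ∘ u i)

  -- The left implication; its defining adjunction is ↙-residual below.
  _↙_ : ∀ {p q r} → Q₁ p r → Q₁ p q → Q₁ q r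
  _↙_ {p} {q} {r} w u = ⋁ {I = Σ[ v ∈ Q₁ q r ] v ∘ u ≤ w} proj₁

  module ≤-Reasoning {p q} = PosetReasoning (L.poset {p} {q})

  private
    pair : ∀ {p q} → Q₁ p q → Q₁ p q → Lift ℓ Bool → Q₁ p q
    pair u u′ (lift b) = if b then u else u′

    ⋁-pair : ∀ {p q} {u u′ : Q₁ p q} → u ≤ u′ → u′ ≈ ⋁ (pair u u′)
    ⋁-pair u≤u′ = L.antisym
      (proj₁ (⋁-isJoin _) (lift false))
      (proj₂ (⋁-isJoin _) (λ { (lift true) → u≤u′ ; (lift false) → L.refl }))

  ∘-monoʳ : ∀ {p q r} (v : Q₁ q r) {u u′ : Q₁ p q} → u ≤ u′ → v ∘ u ≤ v ∘ u′
  ∘-monoʳ v {u} {u′} u≤u′ = begin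
    v ∘ u                        ≤⟨ proj₁ (⋁-isJoin _) (lift true) ⟩
    ⋁ (λ i → v ∘ pair u u′ i)    ≈⟨ ∘-⋁ʳ v (pair u u′) ⟨
    v ∘ ⋁ (pair u u′)            ≈⟨ ∘-cong L.Eq.refl (⋁-pair u≤u′) ⟨
    v ∘ u′                       ∎
    where open ≤-Reasoning

  ∘-monoˡ : ∀ {p q r} (u : Q₁ p q) {v v′ : Q₁ q r} → v ≤ v′ → v ∘ u ≤ v′ ∘ u
  ∘-monoˡ u {v} {v′} v≤v′ = begin
    v ∘ u                        ≤⟨ proj₁ (⋁-isJoin _) (lift true) ⟩
    ⋁ (λ i → pair v v′ i ∘ u)    ≈⟨ ∘-⋁ˡ (pair v v′) u ⟨
    ⋁ (pair v v′) ∘ u            ≈⟨ ∘-cong (⋁-pair v≤v′) L.Eq.refl ⟨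
    v′ ∘ u                       ∎
    where open ≤-Reasoning

  ↙-residual : ∀ {p q r} {u : Q₁ p q} {v : Q₁ q r} {w : Q₁ p r} →
               (v ∘ u ≤ w) ⇔ (v ≤ w ↙ u)
  ↙-residual {u = u} {v} {w} = mk⇔
    (λ vu≤w → proj₁ (⋁-isJoin _) (v , vu≤w))
    (λ v≤w↙u → begin
      v ∘ u                        ≤⟨ ∘-monoˡ u v≤w↙u ⟩
      (w ↙ u) ∘ u                  ≈⟨ ∘-⋁ˡ proj₁ u ⟩
      ⋁ (λ i → proj₁ i ∘ u)        ≤⟨ proj₂ (⋁-isJoin _) proj₂ ⟩
      w                            ∎)
    where open ≤-Reasoning

module _ {ℓ} (𝒬 : Quantaloid ℓ) where
  open Quantaloid 𝒬

  -- A set A with a map |·| : A → Q₀ is encoded by its fibres: S q is the set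
  -- of elements of type q.  Elements are thereby comparable only if they have
  -- the same type.
  TypedSet : Set (suc ℓ)
  TypedSet = Q₀ → Setoid ℓ ℓ

  record QCat : Set (suc ℓ) where
    infix 4 _≼_ _≅_
    field
      obj : TypedSet

    Ob : Q₀ → Set ℓ
    Ob q = Setoid.Carrier (obj q)

    module Ob {q} = Setoid (obj q)

    field
      hom       : ∀ {p q} → Ob p → Ob q → Q₁ p q
      hom-cong  : ∀ {p q} {x x′ : Ob p} {y y′ : Ob q} →
                  x Ob.≈ x′ → y Ob.≈ y′ → hom x y ≈ hom x′ y′
      hom-refl  : ∀ {p} (x : Ob p) → 𝟙 p ≤ hom x x
      hom-trans : ∀ {p q r} (x : Ob p) (y : Ob q) (z : Ob r) →
                  hom y z ∘ hom x y ≤ hom x z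

    _≼_ : ∀ {q} → Rel (Ob q) ℓ
    _≼_ {q} x y = 𝟙 q ≤ hom x y

    _≅_ : ∀ {q} → Rel (Ob q) ℓ
    x ≅ y = x ≼ y × y ≼ x

    IsSeparated : Set ℓ
    IsSeparated = ∀ {q} {x y : Ob q} → x ≅ y → x Ob.≈ y

TypedMap : ∀ {ℓ} {𝒬₀ : Set ℓ} → (S T : 𝒬₀ → Setoid ℓ ℓ) → Set ℓ
TypedMap S T = ∀ q → Func (S q) (T q)

module _ {ℓ} {𝒬 : Quantaloid ℓ} where
  open Quantaloid 𝒬

  record QFunctor (𝔸 𝔹 : QCat 𝒬) : Set ℓ where
    private
      module 𝔸 = QCat 𝔸
      module 𝔹 = QCat 𝔹
    field
      map : TypedMap 𝔸.obj 𝔹.obj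

    to : ∀ {q} → 𝔸.Ob q → 𝔹.Ob q
    to {q} = Func.to (map q)

    field
      hom-≤ : ∀ {p q} (x : 𝔸.Ob p) (y : 𝔸.Ob q) →
              𝔸.hom x y ≤ 𝔹.hom (to x) (to y)

  infix 4 _≃_
  record _≃_ (𝔸 𝔹 : QCat 𝒬) : Set ℓ where
    private
      module 𝔸 = QCat 𝔸
      module 𝔹 = QCat 𝔹
    field
      functor : QFunctor 𝔸 𝔹
      inverse : QFunctor 𝔹 𝔸
    private
      module F = QFunctor functor
      module G = QFunctor inverse
    field
      inverseˡ : ∀ {q} (x : 𝔸.Ob q) → G.to (F.to x) 𝔸.Ob.≈ x
      inverseʳ : ∀ {q} (y : 𝔹.Ob q) → F.to (G.to y) 𝔹.Ob.≈ y

  Subcategory : (𝔸 : QCat 𝒬) → (∀ {q} → QCat.Ob 𝔸 q → Set ℓ) → QCat 𝒬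
  Subcategory 𝔸 P = record
    { obj       = λ q → record
        { Carrier       = Σ (𝔸.Ob q) P
        ; _≈_           = λ x y → proj₁ x 𝔸.Ob.≈ proj₁ y
        ; isEquivalence = record
            { refl = 𝔸.Ob.refl ; sym = 𝔸.Ob.sym ; trans = 𝔸.Ob.trans }
        }
    ; hom       = λ x y → 𝔸.hom (proj₁ x) (proj₁ y)
    ; hom-cong  = 𝔸.hom-cong
    ; hom-refl  = λ x → 𝔸.hom-refl (proj₁ x)
    ; hom-trans = λ x y z → 𝔸.hom-trans (proj₁ x) (proj₁ y) (proj₁ z)
    }
    where module 𝔸 = QCat 𝔸

  -- y ≅ ⋁ᵢ F xᵢ says that y is a join in the preorder of its own fibre; joins
  -- in a preorder are determined up to ≅ only.
  module _ {S : TypedSet 𝒬} (𝕏 : QCat 𝒬) (F : TypedMap S (QCat.obj 𝕏)) where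
    open QCat 𝕏

    ⋁-Dense : Set (suc ℓ)
    ⋁-Dense = ∀ {q} (y : Ob q) →
      Σ[ I ∈ Set ℓ ] Σ[ x ∈ (I → Setoid.Carrier (S q)) ]
        IsJoin _≼_ (λ i → Func.to (F q) (x i)) y

    ⋀-Dense : Set (suc ℓ)
    ⋀-Dense = ∀ {q} (y : Ob q) →
      Σ[ I ∈ Set ℓ ] Σ[ x ∈ (I → Setoid.Carrier (S q)) ]
        IsMeet _≼_ (λ i → Func.to (F q) (x i)) y

module _ {ℓ} (𝒬 : Quantaloid ℓ) (S : TypedSet 𝒬) where
  open Quantaloid 𝒬
  private module S {q} = Setoid (S q)

  record DomPair (r : Q₀) : Set ℓ where
    constructor ⟨_,_⟩
    field
      {type} : Q₀
      elem   : S.Carrier {type}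
      arrow  : Q₁ type r

  -- The constructor forces the two types to agree.
  data DomPair-≈ {r : Q₀} : Rel (DomPair r) ℓ where
    ⟨_,_⟩ : ∀ {p} {a a′ : S.Carrier {p}} {u u′ : Q₁ p r} →
            a S.≈ a′ → u ≈ u′ → DomPair-≈ ⟨ a , u ⟩ ⟨ a′ , u′ ⟩

  _×dom : TypedSet 𝒬
  _×dom r = record
    { Carrier       = DomPair r
    ; _≈_           = DomPair-≈
    ; isEquivalence = record
        { refl  = ⟨ S.refl , L.Eq.refl ⟩
        ; sym   = λ { ⟨ e , f ⟩ → ⟨ S.sym e , L.Eq.sym f ⟩ }
        ; trans = λ { ⟨ e , f ⟩ ⟨ e′ , f′ ⟩ →
                      ⟨ S.trans e e′ , L.Eq.trans f f′ ⟩ }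
        }
    }

module _ {ℓ} {𝒬 : Quantaloid ℓ} where
  open Quantaloid 𝒬

  -- That a distributor respects equality of objects follows from act, as
  -- x ≈ x′ implies 𝟙 ≤ hom x x′.
  record Dist (𝔸 𝔹 : QCat 𝒬) : Set ℓ where
    private
      module 𝔸 = QCat 𝔸
      module 𝔹 = QCat 𝔹
    field
      at  : ∀ {p q} → 𝔸.Ob p → 𝔹.Ob q → Q₁ p q
      act : ∀ {p p′ q q′} (x : 𝔸.Ob p) (x′ : 𝔸.Ob p′) (y : 𝔹.Ob q) (y′ : 𝔹.Ob q′) →
            𝔹.hom y y′ ∘ at x y ∘ 𝔸.hom x′ x ≤ at x′ y′

    actˡ : ∀ {p q q′} (x : 𝔸.Ob p) (y : 𝔹.Ob q) (y′ : 𝔹.Ob q′) →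
           𝔹.hom y y′ ∘ at x y ≤ at x y′
    actˡ {p} x y y′ = begin
      𝔹.hom y y′ ∘ at x y                  ≈⟨ ∘-cong L.Eq.refl (identityʳ _) ⟨
      𝔹.hom y y′ ∘ at x y ∘ 𝟙 p            ≤⟨ ∘-monoʳ _ (∘-monoʳ _ (𝔸.hom-refl x)) ⟩
      𝔹.hom y y′ ∘ at x y ∘ 𝔸.hom x x      ≤⟨ act x x y y′ ⟩
      at x y′                              ∎
      where open ≤-Reasoning

    actʳ : ∀ {p p′ q} (x : 𝔸.Ob p) (x′ : 𝔸.Ob p′) (y : 𝔹.Ob q) →
           at x y ∘ 𝔸.hom x′ x ≤ at x′ y
    actʳ {q = q} x x′ y = begin
      at x y ∘ 𝔸.hom x′ x                  ≈⟨ identityˡ _ ⟨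
      𝟙 q ∘ at x y ∘ 𝔸.hom x′ x            ≤⟨ ∘-monoˡ _ (𝔹.hom-refl y) ⟩
      𝔹.hom y y ∘ at x y ∘ 𝔸.hom x′ x      ≤⟨ act x x′ y y ⟩
      at x′ y                              ∎
      where open ≤-Reasoning

  homDist : (𝔸 : QCat 𝒬) → Dist 𝔸 𝔸
  homDist 𝔸 = record
    { at  = hom
    ; act = λ x x′ y y′ →
        L.trans (∘-monoʳ _ (hom-trans x′ x y)) (hom-trans x′ y y′)
    }
    where open QCat 𝔸

  infixr 9 _⊙_
  _⊙_ : ∀ {𝔸 𝔹 ℂ : QCat 𝒬} → Dist 𝔹 ℂ → Dist 𝔸 𝔹 → Dist 𝔸 ℂ
  _⊙_ {𝔸} {𝔹} {ℂ} ψ φ = record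
    { at  = λ x z → ⋁ (term x z)
    ; act = λ x x′ z z′ → begin
        ℂ.hom z z′ ∘ ⋁ (term x z) ∘ 𝔸.hom x′ x
          ≈⟨ ∘-cong L.Eq.refl (∘-⋁ˡ _ _) ⟩
        ℂ.hom z z′ ∘ ⋁ (λ i → term x z i ∘ 𝔸.hom x′ x)
          ≈⟨ ∘-⋁ʳ _ _ ⟩
        ⋁ (λ i → ℂ.hom z z′ ∘ term x z i ∘ 𝔸.hom x′ x)
          ≤⟨ proj₂ (⋁-isJoin _) (λ i → let y = proj₂ i in begin
               ℂ.hom z z′ ∘ (ψ.at y z ∘ φ.at x y) ∘ 𝔸.hom x′ x
                 ≈⟨ ∘-cong L.Eq.refl (assoc _ _ _) ⟩
               ℂ.hom z z′ ∘ ψ.at y z ∘ φ.at x y ∘ 𝔸.hom x′ x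
                 ≤⟨ ∘-monoʳ _ (∘-monoʳ _ (φ.actʳ x x′ y)) ⟩
               ℂ.hom z z′ ∘ ψ.at y z ∘ φ.at x′ y
                 ≈⟨ assoc _ _ _ ⟨
               (ℂ.hom z z′ ∘ ψ.at y z) ∘ φ.at x′ y
                 ≤⟨ ∘-monoˡ _ (ψ.actˡ y z z′) ⟩
               term x′ z′ i
                 ≤⟨ proj₁ (⋁-isJoin _) i ⟩
               ⋁ (term x′ z′)
                 ∎) ⟩
        ⋁ (term x′ z′)
          ∎
    }
    where
    module 𝔸 = QCat 𝔸
    module 𝔹 = QCat 𝔹
    module ℂ = QCat ℂ
    module φ = Dist φ
    module ψ = Dist ψ
    open ≤-Reasoning
    term : ∀ {p r} → 𝔸.Ob p → ℂ.Ob r → Σ Q₀ 𝔹.Ob → Q₁ p r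
    term x z (_ , y) = ψ.at y z ∘ φ.at x y

  infixl 8 _↙ᵈ_
  _↙ᵈ_ : ∀ {𝔸 𝔹 ℂ : QCat 𝒬} → Dist 𝔸 ℂ → Dist 𝔸 𝔹 → Dist 𝔹 ℂ
  _↙ᵈ_ {𝔸} {𝔹} {ℂ} ξ φ = record
    { at  = λ y z → ⋀ (term y z)
    ; act = λ y y′ z z′ → proj₂ (⋀-isMeet _) (λ i → let x = proj₂ i in
        Equivalence.to ↙-residual (begin
          (ℂ.hom z z′ ∘ ⋀ (term y z) ∘ 𝔹.hom y′ y) ∘ φ.at x y′
            ≈⟨ assoc _ _ _ ⟩
          ℂ.hom z z′ ∘ (⋀ (term y z) ∘ 𝔹.hom y′ y) ∘ φ.at x y′
            ≈⟨ ∘-cong L.Eq.refl (assoc _ _ _) ⟩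
          ℂ.hom z z′ ∘ ⋀ (term y z) ∘ 𝔹.hom y′ y ∘ φ.at x y′
            ≤⟨ ∘-monoʳ _ (∘-monoʳ _ (φ.actˡ x y′ y)) ⟩
          ℂ.hom z z′ ∘ ⋀ (term y z) ∘ φ.at x y
            ≤⟨ ∘-monoʳ _ (Equivalence.from ↙-residual (proj₁ (⋀-isMeet _) i)) ⟩
          ℂ.hom z z′ ∘ ξ.at x z
            ≤⟨ ξ.actˡ x z z′ ⟩
          ξ.at x z′
            ∎))
    }
    where
    module 𝔸 = QCat 𝔸
    module 𝔹 = QCat 𝔹
    module ℂ = QCat ℂ
    module φ = Dist φ
    module ξ = Dist ξ
    open ≤-Reasoning
    term : ∀ {q r} → 𝔹.Ob q → ℂ.Ob r → Σ Q₀ 𝔸.Ob → Q₁ q r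
    term y z (_ , x) = ξ.at x z ↙ φ.at x y

  infix 4 _≈ᵈ_
  _≈ᵈ_ : ∀ {𝔸 𝔹 : QCat 𝒬} → Rel (Dist 𝔸 𝔹) ℓ
  _≈ᵈ_ {𝔸} {𝔹} φ φ′ = ∀ {p q} (x : QCat.Ob 𝔸 p) (y : QCat.Ob 𝔹 q) →
    Dist.at φ x y ≈ Dist.at φ′ x y

-- The category {q}: its set of objects of type p is q ≡ p, so that its only
-- object is refl, of type q.
module _ {ℓ} (𝒬 : Quantaloid ℓ) where
  open Quantaloid 𝒬

  Singleton : Q₀ → QCat 𝒬
  Singleton q = record
    { obj       = λ p → setoid (q ≡ p)
    ; hom       = λ { refl refl → 𝟙 q }
    ; hom-cong  = λ { refl refl → L.Eq.refl }
    ; hom-refl  = λ { refl → L.refl }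
    ; hom-trans = λ { refl refl refl → L.reflexive (identityˡ _) }
    }

module _ {ℓ} {𝒬 : Quantaloid ℓ} where
  open Quantaloid 𝒬

  Presheaf : QCat 𝒬 → Q₀ → Set ℓ
  Presheaf 𝔸 q = Dist 𝔸 (Singleton 𝒬 q)

  P : QCat 𝒬 → QCat 𝒬
  P 𝔸 = record
    { obj       = λ q → record
        { Carrier       = Presheaf 𝔸 q
        ; _≈_           = _≈ᵈ_
        ; isEquivalence = record
            { refl  = λ x y → L.Eq.refl
            ; sym   = λ e x y → L.Eq.sym (e x y)
            ; trans = λ e f x y → L.Eq.trans (e x y) (f x y)
            }
        }
    ; hom       = phom
    ; hom-cong  = λ {_} {_} {μ} {μ′} {ν} {ν′} e f → L.antisym
        (phom-mono {μ = μ} {μ′} {ν} {ν′} e f)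
        (phom-mono {μ = μ′} {μ} {ν′} {ν}
          (λ x y → L.Eq.sym (e x y)) (λ x y → L.Eq.sym (f x y)))
    ; hom-refl  = λ μ → proj₂ (⋀-isMeet _) (λ _ →
        Equivalence.to ↙-residual (L.reflexive (identityˡ _)))
    ; hom-trans = λ μ ν ξ → proj₂ (⋀-isMeet _) (λ { (_ , x) →
        Equivalence.to ↙-residual (begin
          (phom ν ξ ∘ phom μ ν) ∘ Dist.at μ x refl  ≈⟨ assoc _ _ _ ⟩
          phom ν ξ ∘ phom μ ν ∘ Dist.at μ x refl    ≤⟨ ∘-monoʳ _ (eval μ ν x) ⟩
          phom ν ξ ∘ Dist.at ν x refl               ≤⟨ eval ν ξ x ⟩
          Dist.at ξ x refl                          ∎) })
    }
    where
    open ≤-Reasoning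
    phom : ∀ {p q} → Presheaf 𝔸 p → Presheaf 𝔸 q → Q₁ p q
    phom μ μ′ = Dist.at (μ′ ↙ᵈ μ) refl refl

    eval : ∀ {p q r} (μ : Presheaf 𝔸 p) (ν : Presheaf 𝔸 q) (x : QCat.Ob 𝔸 r) →
           phom μ ν ∘ Dist.at μ x refl ≤ Dist.at ν x refl
    eval μ ν x = Equivalence.from ↙-residual (proj₁ (⋀-isMeet _) (_ , x))

    phom-mono : ∀ {p q} {μ μ′ : Presheaf 𝔸 p} {ν ν′ : Presheaf 𝔸 q} →
                μ ≈ᵈ μ′ → ν ≈ᵈ ν′ → phom μ ν ≤ phom μ′ ν′
    phom-mono {μ = μ} {μ′} {ν} {ν′} e f = proj₂ (⋀-isMeet _) (λ { (_ , x) →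
      Equivalence.to ↙-residual (begin
        phom μ ν ∘ Dist.at μ′ x refl   ≈⟨ ∘-cong L.Eq.refl (e x refl) ⟨
        phom μ ν ∘ Dist.at μ x refl    ≤⟨ eval μ ν x ⟩
        Dist.at ν x refl               ≈⟨ f x refl ⟩
        Dist.at ν′ x refl              ∎) })

  IsSup : (𝔸 : QCat 𝒬) → ∀ {q} → Presheaf 𝔸 q → QCat.Ob 𝔸 q → Set ℓ
  IsSup 𝔸 μ s = ∀ {r} (x : QCat.Ob 𝔸 r) →
    QCat.hom 𝔸 s x ≈ Dist.at (homDist 𝔸 ↙ᵈ μ) refl x

  IsComplete : QCat 𝒬 → Set ℓ
  IsComplete 𝔸 = ∀ {q} (μ : Presheaf 𝔸 q) → Σ[ s ∈ QCat.Ob 𝔸 q ] IsSup 𝔸 μ s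

  _^* : ∀ {𝔸 𝔹 : QCat 𝒬} → Dist 𝔸 𝔹 → ∀ {q} → Presheaf 𝔹 q → Presheaf 𝔸 q
  (φ ^*) ν = ν ⊙ φ

  _⁎ : ∀ {𝔸 𝔹 : QCat 𝒬} → Dist 𝔸 𝔹 → ∀ {q} → Presheaf 𝔸 q → Presheaf 𝔹 q
  (φ ⁎) μ = μ ↙ᵈ φ

  K : ∀ {𝔸 𝔹 : QCat 𝒬} → Dist 𝔸 𝔹 → QCat 𝒬
  K {𝔹 = 𝔹} φ = Subcategory (P 𝔹) (λ ν → (φ ⁎) ((φ ^*) ν) ≈ᵈ ν)

{-# OPTIONS --safe #-}
module Submission where

open import Defs
open import Level using (Level; suc)
open import Data.Product.Base using (Σ; Σ-syntax; _×_; _,_; proj₁; proj₂)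
open import Data.Unit.Polymorphic.Base using (⊤)
open import Function.Base using (_$_)
open import Function.Bundles using (Func; _⇔_; mk⇔; module Equivalence)
open import Relation.Binary.PropositionalEquality using (refl)

-- The presheaf closure φ⁎φ* on 𝔹 has K φ as its category of fixed points, and
-- both directions rest on two canonical families of fixed points.  The presheaf
-- 𝔹(-,b) weighted by v has closure F(b,v), and homming out of it evaluates:
-- K φ(F(b,v),λ) = λ(b) ↙ v.  The presheaf G(a,u) = u ↙ φ(a,-) is already
-- closed.  Thus K φ(F(b,v),G(a,u)) = (u ↙ φ(a,b)) ↙ v.  A closed λ is the join
-- of those F(b,v) with v ≤ λ(b), and the meet of the G(a,φ*λ(a)), the latter
-- being exactly the equation φ⁎φ*λ = λ.  An isomorphism carries all of this
-- from K φ to 𝕏.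
--
-- Conversely, given F and G on 𝕏, let λ_x(b) = 𝕏(F(b,1),x).  Completeness makes
-- order-theoretic joins and meets in a fibre of 𝕏 into enriched ones
-- (hom-join, hom-meet), since the weighted suprema of weightedSup include
-- tensors and fibrewise joins.  Writing x as a meet of G(aᵢ,uᵢ), the formula
-- for 𝕏(F(b,v),G(a,u)) gives: w ≤ 𝕏(F(b,v),x) iff (w ∘ v) ∘ φ(aᵢ,b) ≤ uᵢ for
-- all i.  From this, λ_x is a presheaf, is closed, and satisfies
-- 𝕏(F(b,v),x) = λ_x(b) ↙ v.  Writing x as a join of F(bⱼ,vⱼ), where then
-- vⱼ ≤ λ_x(bⱼ), shows that x ↦ λ_x is fully faithful.  It is surjective: for
-- closed λ the supremum x of the F(b,1) weighted by λ(b) has λ ≤ λ_x, while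
-- x ≼ G(a,φ*λ(a)) for all a, so λ_x ≤ φ⁎φ*λ = λ.  Since 𝕏 is separated, a fully
-- faithful surjective functor out of it is an isomorphism.

-- Inequalities in a quantaloid

module Arrows {ℓ} (𝒬 : Quantaloid ℓ) where
  open Quantaloid 𝒬 public

  curry : ∀ {p q r} {u : Q₁ p q} {v : Q₁ q r} {w : Q₁ p r} →
          v ∘ u ≤ w → v ≤ w ↙ u
  curry = Equivalence.to ↙-residual

  uncurry : ∀ {p q r} {u : Q₁ p q} {v : Q₁ q r} {w : Q₁ p r} →
            v ≤ w ↙ u → v ∘ u ≤ w
  uncurry = Equivalence.from ↙-residual

  𝟙-introˡ : ∀ {p q} {u w : Q₁ p q} → u ≤ w → 𝟙 q ∘ u ≤ w
  𝟙-introˡ = L.trans (L.reflexive (identityˡ _))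

  𝟙-elimˡ : ∀ {p q} {u w : Q₁ p q} → 𝟙 q ∘ u ≤ w → u ≤ w
  𝟙-elimˡ = L.trans (L.reflexive (L.Eq.sym (identityˡ _)))

  𝟙-introʳ : ∀ {p q} {u w : Q₁ p q} → u ≤ w → u ∘ 𝟙 p ≤ w
  𝟙-introʳ = L.trans (L.reflexive (identityʳ _))

  𝟙-elimʳ : ∀ {p q} {u w : Q₁ p q} → u ∘ 𝟙 p ≤ w → u ≤ w
  𝟙-elimʳ = L.trans (L.reflexive (L.Eq.sym (identityʳ _)))

  assocˡ : ∀ {p q r s} {w : Q₁ r s} {v : Q₁ q r} {u : Q₁ p q} {t : Q₁ p s} →
           w ∘ (v ∘ u) ≤ t → (w ∘ v) ∘ u ≤ t
  assocˡ = L.trans (L.reflexive (assoc _ _ _))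

  assocʳ : ∀ {p q r s} {w : Q₁ r s} {v : Q₁ q r} {u : Q₁ p q} {t : Q₁ p s} →
           (w ∘ v) ∘ u ≤ t → w ∘ (v ∘ u) ≤ t
  assocʳ = L.trans (L.reflexive (L.Eq.sym (assoc _ _ _)))

  ∘-⋁-least : ∀ {p q r} {I : Set ℓ} {w : Q₁ q r} {u : I → Q₁ p q} {t : Q₁ p r} →
              (∀ i → w ∘ u i ≤ t) → w ∘ ⋁ u ≤ t
  ∘-⋁-least h = L.trans (L.reflexive (∘-⋁ʳ _ _)) (proj₂ (⋁-isJoin _) h)

  ⋁-∘-least : ∀ {p q r} {I : Set ℓ} {w : I → Q₁ q r} {u : Q₁ p q} {t : Q₁ p r} →
              (∀ i → w i ∘ u ≤ t) → ⋁ w ∘ u ≤ t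
  ⋁-∘-least h = L.trans (L.reflexive (∘-⋁ˡ _ _)) (proj₂ (⋁-isJoin _) h)

  -- Two arrows with the same lower bounds agree.
  ≈-from-below : ∀ {p q} {u v : Q₁ p q} → (∀ {w} → (w ≤ u) ⇔ (w ≤ v)) → u ≈ v
  ≈-from-below h = L.antisym (Equivalence.to h L.refl) (Equivalence.from h L.refl)

-- Presheaves and their closure

module Presheaves {ℓ} {𝒬 : Quantaloid ℓ} where
  open Arrows 𝒬

  module _ (𝔸 : QCat 𝒬) where
    open QCat 𝔸

    -- A presheaf of type q as a family of arrows into q; only the action of 𝔸
    -- carries information, as the one-object category on q acts by 𝟙 q.
    presheaf : ∀ {q} (f : ∀ {p} → Ob p → Q₁ p q) →
               (∀ {p p′} (x : Ob p) (x′ : Ob p′) → f x ∘ hom x′ x ≤ f x′) →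
               Presheaf 𝔸 q
    presheaf f f-act = record
      { at  = λ { x refl → f x }
      ; act = λ { x x′ refl refl → 𝟙-introˡ (f-act x x′) }
      }

  module _ {𝔸 : QCat 𝒬} where
    open QCat 𝔸

    -- The arrow μ(x), from the type of x to the type of μ.
    infixl 10 _⟦_⟧
    _⟦_⟧ : ∀ {p q} → Presheaf 𝔸 q → Ob p → Q₁ p q
    μ ⟦ x ⟧ = Dist.at μ x refl

    -- P 𝔸(μ,ν) is the largest w with w ∘ μ(x) ≤ ν(x) for all x.
    hom-P-intro : ∀ {p q} {μ : Presheaf 𝔸 p} {ν : Presheaf 𝔸 q} {w : Q₁ p q} →
                  (∀ {r} (x : Ob r) → w ∘ μ ⟦ x ⟧ ≤ ν ⟦ x ⟧) →
                  w ≤ QCat.hom (P 𝔸) μ ν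
    hom-P-intro h = proj₂ (⋀-isMeet _) (λ (_ , x) → curry (h x))

    hom-P-elim : ∀ {p q} {μ : Presheaf 𝔸 p} {ν : Presheaf 𝔸 q} {w : Q₁ p q} →
                 w ≤ QCat.hom (P 𝔸) μ ν →
                 ∀ {r} (x : Ob r) → w ∘ μ ⟦ x ⟧ ≤ ν ⟦ x ⟧
    hom-P-elim h x = uncurry (L.trans h (proj₁ (⋀-isMeet _) (_ , x)))

    P-≼-intro : ∀ {q} {μ ν : Presheaf 𝔸 q} →
                (∀ {r} (x : Ob r) → μ ⟦ x ⟧ ≤ ν ⟦ x ⟧) → QCat._≼_ (P 𝔸) μ ν
    P-≼-intro {μ = μ} {ν} h = hom-P-intro {μ = μ} {ν} (λ x → 𝟙-introˡ (h x))

    P-≼-elim : ∀ {q} {μ ν : Presheaf 𝔸 q} → QCat._≼_ (P 𝔸) μ ν →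
               ∀ {r} (x : Ob r) → μ ⟦ x ⟧ ≤ ν ⟦ x ⟧
    P-≼-elim {μ = μ} {ν} h x = 𝟙-elimˡ (hom-P-elim {μ = μ} {ν} h x)

    P-antisym : ∀ {q} {μ ν : Presheaf 𝔸 q} →
                (∀ {r} (x : Ob r) → μ ⟦ x ⟧ ≤ ν ⟦ x ⟧) →
                (∀ {r} (x : Ob r) → ν ⟦ x ⟧ ≤ μ ⟦ x ⟧) → μ ≈ᵈ ν
    P-antisym h k x refl = L.antisym (h x) (k x)

    -- The representable presheaf of x weighted by v.
    _⊗y_ : ∀ {p q} → Q₁ p q → Ob p → Presheaf 𝔸 q
    v ⊗y x = presheaf 𝔸 (λ z → v ∘ hom z x)
      (λ z z′ → assocˡ (∘-monoʳ v (hom-trans z′ z x)))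

    -- The Yoneda lemma, in weighted form.
    ⊗y-least : ∀ {p q r} {v : Q₁ p q} {x : Ob p} {ν : Presheaf 𝔸 r} {w : Q₁ q r} →
               w ∘ v ≤ ν ⟦ x ⟧ → ∀ {s} (z : Ob s) → w ∘ (v ⊗y x) ⟦ z ⟧ ≤ ν ⟦ z ⟧
    ⊗y-least {x = x} {ν} h z =
      assocʳ (L.trans (∘-monoˡ _ h) (Dist.actʳ ν x z refl))

    ⊗y-at : ∀ {p q} (v : Q₁ p q) (x : Ob p) → v ≤ (v ⊗y x) ⟦ x ⟧
    ⊗y-at v x = 𝟙-elimʳ (∘-monoʳ v (hom-refl x))

  module _ {𝔸 𝔹 : QCat 𝒬} (φ : Dist 𝔸 𝔹) where
    private
      module 𝔸 = QCat 𝔸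
      module 𝔹 = QCat 𝔹
      module φ = Dist φ

    -- The value φ⁎μ(y) is the largest w with w ∘ φ(x,y) ≤ μ(x) for all x.
    ⁎-intro : ∀ {q r} {μ : Presheaf 𝔸 q} {y : 𝔹.Ob r} {w : Q₁ r q} →
              (∀ {p} (x : 𝔸.Ob p) → w ∘ φ.at x y ≤ μ ⟦ x ⟧) → w ≤ ((φ ⁎) μ) ⟦ y ⟧
    ⁎-intro h = proj₂ (⋀-isMeet _) (λ (_ , x) → curry (h x))

    ⁎-elim : ∀ {q r} {μ : Presheaf 𝔸 q} {y : 𝔹.Ob r} {w : Q₁ r q} →
             w ≤ ((φ ⁎) μ) ⟦ y ⟧ → ∀ {p} (x : 𝔸.Ob p) → w ∘ φ.at x y ≤ μ ⟦ x ⟧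
    ⁎-elim h x = uncurry (L.trans h (proj₁ (⋀-isMeet _) (_ , x)))

    ^*-intro : ∀ {p q r} (ν : Presheaf 𝔹 q) (x : 𝔸.Ob p) (y : 𝔹.Ob r) →
               ν ⟦ y ⟧ ∘ φ.at x y ≤ ((φ ^*) ν) ⟦ x ⟧
    ^*-intro ν x y = proj₁ (⋁-isJoin {I = Σ Q₀ 𝔹.Ob} _) (_ , y)

    -- The composite φ⁎φ*.
    closure : ∀ {q} → Presheaf 𝔹 q → Presheaf 𝔹 q
    closure ν = (φ ⁎) ((φ ^*) ν)

    -- Membership in K φ.
    Closed : ∀ {q} → Presheaf 𝔹 q → Set ℓ
    Closed ν = closure ν ≈ᵈ ν

    closure-extensive : ∀ {q r} (ν : Presheaf 𝔹 q) (y : 𝔹.Ob r) →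
                        ν ⟦ y ⟧ ≤ closure ν ⟦ y ⟧
    closure-extensive ν y = ⁎-intro {μ = (φ ^*) ν} (λ x → ^*-intro ν x y)

    -- The closure is enriched: it is compatible with composition by any w.
    closure-mono : ∀ {q q′} {μ : Presheaf 𝔹 q} {ν : Presheaf 𝔹 q′} {w : Q₁ q q′} →
                   (∀ {r} (y : 𝔹.Ob r) → w ∘ μ ⟦ y ⟧ ≤ ν ⟦ y ⟧) →
                   ∀ {r} (y : 𝔹.Ob r) → w ∘ closure μ ⟦ y ⟧ ≤ closure ν ⟦ y ⟧
    closure-mono {μ = μ} {ν} h y = ⁎-intro {μ = (φ ^*) ν} $ λ x →
      assocˡ $ L.trans (∘-monoʳ _ (⁎-elim {μ = (φ ^*) μ} L.refl x)) $
      ∘-⋁-least λ { (_ , y′) →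
        assocʳ (L.trans (∘-monoˡ _ (h y′)) (^*-intro ν x y′)) }

    -- A presheaf is closed as soon as, at each y, it is above every w with
    -- w ∘ φ(x,y) ≤ φ*ν(x) for all x.
    closed : ∀ {q} {ν : Presheaf 𝔹 q} →
             (∀ {r} (y : 𝔹.Ob r) {w : Q₁ r q} →
               (∀ {p} (x : 𝔸.Ob p) → w ∘ φ.at x y ≤ ((φ ^*) ν) ⟦ x ⟧) →
               w ≤ ν ⟦ y ⟧) →
             Closed ν
    closed {ν = ν} h = P-antisym {μ = closure ν} {ν}
      (λ y → h y (⁎-elim {μ = (φ ^*) ν} L.refl))
      (closure-extensive ν)

    ⁎-closed : ∀ {q} (μ : Presheaf 𝔸 q) → Closed ((φ ⁎) μ)
    ⁎-closed μ = closed {ν = (φ ⁎) μ} λ y h → ⁎-intro {μ = μ} λ x →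
      L.trans (h x) $ proj₂ (⋁-isJoin _) λ _ →
      ⁎-elim {μ = μ} L.refl x

-- Isomorphisms

module Isomorphisms {ℓ} {𝒬 : Quantaloid ℓ} where
  open Arrows 𝒬

  module _ {𝔸 𝔹 : QCat 𝒬} where
    private
      module 𝔸 = QCat 𝔸
      module 𝔹 = QCat 𝔹

    module _ (T : QFunctor 𝔸 𝔹) where
      open QFunctor T using (to; hom-≤)

      -- A fully faithful functor that reaches every object up to equality is an
      -- isomorphism if its domain is separated, which makes the chosen
      -- preimages respect equality.
      ff-surjective⇒≃ :
        𝔸.IsSeparated →
        (∀ {p q} (x : 𝔸.Ob p) (y : 𝔸.Ob q) → 𝔹.hom (to x) (to y) ≤ 𝔸.hom x y) →
        (∀ {q} (y : 𝔹.Ob q) → Σ[ x ∈ 𝔸.Ob q ] to x 𝔹.Ob.≈ y) →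
        𝔸 ≃ 𝔹
      ff-surjective⇒≃ separated full surjective = record
        { functor  = T
        ; inverse  = record
            { map   = λ q → record
                { to   = from
                ; cong = λ e → separated (from-≼ e , from-≼ (𝔹.Ob.sym e))
                }
            ; hom-≤ = from-hom
            }
        ; inverseˡ = λ x → separated
            (full-≼ (from-to (to x)) , full-≼ (𝔹.Ob.sym (from-to (to x))))
        ; inverseʳ = from-to
        }
        where
        from : ∀ {q} → 𝔹.Ob q → 𝔸.Ob q
        from y = proj₁ (surjective y)

        from-to : ∀ {q} (y : 𝔹.Ob q) → to (from y) 𝔹.Ob.≈ y
        from-to y = proj₂ (surjective y)

        full-≼ : ∀ {q} {x x′ : 𝔸.Ob q} → to x 𝔹.Ob.≈ to x′ → x 𝔸.≼ x′
        full-≼ {x = x} {x′} e = L.trans (𝔹.hom-refl (to x)) $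
          L.trans (L.reflexive (𝔹.hom-cong 𝔹.Ob.refl e)) (full x x′)

        from-≼ : ∀ {q} {y y′ : 𝔹.Ob q} → y 𝔹.Ob.≈ y′ → from y 𝔸.≼ from y′
        from-≼ e = full-≼
          (𝔹.Ob.trans (from-to _) (𝔹.Ob.trans e (𝔹.Ob.sym (from-to _))))

        from-hom : ∀ {p q} (y : 𝔹.Ob p) (y′ : 𝔹.Ob q) →
                   𝔹.hom y y′ ≤ 𝔸.hom (from y) (from y′)
        from-hom y y′ = L.trans
          (L.reflexive (L.Eq.sym (𝔹.hom-cong (from-to y) (from-to y′))))
          (full (from y) (from y′))

    module Transport (iso : 𝔸 ≃ 𝔹) where
      open _≃_ iso
      private
        module T = QFunctor functor
        module T⁻¹ = QFunctor inverse

      hom-to : ∀ {p q} (x : 𝔸.Ob p) (y : 𝔹.Ob q) →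
               𝔹.hom (T.to x) y ≤ 𝔸.hom x (T⁻¹.to y)
      hom-to x y = L.trans (T⁻¹.hom-≤ _ _)
        (L.reflexive (𝔸.hom-cong (inverseˡ x) 𝔸.Ob.refl))

      to-hom : ∀ {p q} (x : 𝔸.Ob p) (y : 𝔹.Ob q) →
               𝔸.hom x (T⁻¹.to y) ≤ 𝔹.hom (T.to x) y
      to-hom x y = L.trans (T.hom-≤ _ _)
        (L.reflexive (𝔹.hom-cong 𝔹.Ob.refl (inverseʳ y)))

      hom-from : ∀ {p q} (y : 𝔹.Ob p) (x : 𝔸.Ob q) →
                 𝔹.hom y (T.to x) ≤ 𝔸.hom (T⁻¹.to y) x
      hom-from y x = L.trans (T⁻¹.hom-≤ _ _)
        (L.reflexive (𝔸.hom-cong 𝔸.Ob.refl (inverseˡ x)))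

      from-hom : ∀ {p q} (y : 𝔹.Ob p) (x : 𝔸.Ob q) →
                 𝔸.hom (T⁻¹.to y) x ≤ 𝔹.hom y (T.to x)
      from-hom y x = L.trans (T.hom-≤ _ _)
        (L.reflexive (𝔹.hom-cong (inverseʳ y) 𝔹.Ob.refl))

      hom-inverse : ∀ {p q} (y : 𝔹.Ob p) (y′ : 𝔹.Ob q) →
                    𝔹.hom y y′ ≈ 𝔸.hom (T⁻¹.to y) (T⁻¹.to y′)
      hom-inverse y y′ = L.antisym (T⁻¹.hom-≤ y y′)
        (L.trans (from-hom y (T⁻¹.to y′))
                 (L.reflexive (𝔹.hom-cong 𝔹.Ob.refl (inverseʳ y′))))

      module _ {S : TypedSet 𝒬} (H : TypedMap S 𝔹.obj) where

        -- H followed by the inverse isomorphism.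
        along : TypedMap S 𝔸.obj
        along q = record
          { to   = λ s → T⁻¹.to (Func.to (H q) s)
          ; cong = λ e → Func.cong (T⁻¹.map q) (Func.cong (H q) e)
          }

        along-⋁-dense : ⋁-Dense 𝔹 H → ⋁-Dense 𝔸 along
        along-⋁-dense dense x with dense (T.to x)
        ... | I , s , upper , least = I , s
          , (λ i → L.trans (upper i) (hom-from _ _))
          , λ h → L.trans (least (λ i → L.trans (h i) (from-hom _ _)))
                    (L.trans (T⁻¹.hom-≤ _ _) (L.reflexive
                      (𝔸.hom-cong (inverseˡ x) (inverseˡ _))))

        along-⋀-dense : ⋀-Dense 𝔹 H → ⋀-Dense 𝔸 along
        along-⋀-dense dense x with dense (T.to x)
        ... | I , s , lower , greatest = I , s
          , (λ i → L.trans (lower i) (hom-to _ _))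
          , λ h → L.trans (greatest (λ i → L.trans (h i) (to-hom _ _)))
                    (L.trans (T⁻¹.hom-≤ _ _) (L.reflexive
                      (𝔸.hom-cong (inverseˡ _) (inverseˡ x))))

-- Suprema, joins and meets in a complete category

module Complete {ℓ} {𝒬 : Quantaloid ℓ} (𝕏 : QCat 𝒬) (complete : IsComplete 𝕏) where
  open Arrows 𝒬
  open Presheaves {𝒬 = 𝒬}
  open QCat 𝕏

  -- The supremum of the x i weighted by the c i: the supremum of the presheaf
  -- z ↦ ⋁ᵢ c i ∘ 𝕏(z, x i).
  weightedSup : ∀ {I : Set ℓ} {q} {p : I → Q₀} (x : ∀ i → Ob (p i))
                (c : ∀ i → Q₁ (p i) q) →
                Σ[ s ∈ Ob q ] (∀ {r} {y : Ob r} {w : Q₁ q r} →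
                  (w ≤ hom s y) ⇔ (∀ i → w ∘ c i ≤ hom (x i) y))
  weightedSup {I} {q} x c = s , mk⇔ out into
    where
    μ : Presheaf 𝕏 q
    μ = presheaf 𝕏 (λ z → ⋁ (λ i → c i ∘ hom z (x i)))
      (λ z z′ → ⋁-∘-least λ i → assocˡ $
        L.trans (∘-monoʳ _ (hom-trans z′ z (x i))) (proj₁ (⋁-isJoin _) i))

    s : Ob q
    s = proj₁ (complete μ)

    out : ∀ {r} {y : Ob r} {w : Q₁ q r} →
          w ≤ hom s y → ∀ i → w ∘ c i ≤ hom (x i) y
    out {y = y} {w} h i = begin
      w ∘ c i                    ≤⟨ ∘-monoʳ w (𝟙-elimʳ (∘-monoʳ _ (hom-refl (x i)))) ⟩
      w ∘ c i ∘ hom (x i) (x i)  ≤⟨ ∘-monoʳ w (proj₁ (⋁-isJoin _) i) ⟩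
      w ∘ μ ⟦ x i ⟧
        ≤⟨ uncurry (L.trans (L.trans h (L.reflexive (proj₂ (complete μ) y)))
                            (proj₁ (⋀-isMeet {I = Σ Q₀ Ob} _) (_ , x i))) ⟩
      hom (x i) y                ∎
      where open ≤-Reasoning

    into : ∀ {r} {y : Ob r} {w : Q₁ q r} →
           (∀ i → w ∘ c i ≤ hom (x i) y) → w ≤ hom s y
    into {y = y} h = L.trans
      (proj₂ (⋀-isMeet {I = Σ Q₀ Ob} _) λ (_ , z) → curry $ ∘-⋁-least λ i → assocʳ $
        L.trans (∘-monoˡ _ (h i)) (hom-trans z (x i) y))
      (L.reflexive (L.Eq.sym (proj₂ (complete μ) y)))

  -- A meet in a fibre is a conical limit; w ≤ 𝕏(y,x) is tested on the tensor
  -- of y by w.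
  hom-meet : ∀ {I : Set ℓ} {q} {f : I → Ob q} {x : Ob q} → IsMeet _≼_ f x →
             ∀ {p} {y : Ob p} {w : Q₁ p q} → (∀ i → w ≤ hom y (f i)) → w ≤ hom y x
  hom-meet (_ , greatest) {y = y} {w} h
    with weightedSup {I = ⊤} (λ _ → y) (λ _ → w)
  ... | _ , tensor = 𝟙-elimˡ $ Equivalence.to tensor
    (greatest λ i → Equivalence.from tensor λ _ → 𝟙-introˡ (h i)) _

  -- A join in a fibre is a conical colimit, being the supremum weighted by
  -- identities.
  hom-join : ∀ {I : Set ℓ} {q} {f : I → Ob q} {x : Ob q} → IsJoin _≼_ f x →
             ∀ {r} {y : Ob r} {w : Q₁ q r} → (∀ i → w ≤ hom (f i) y) → w ≤ hom x y
  hom-join {f = f} {x} (_ , least) {y = y} {w} h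
    with weightedSup f (λ _ → 𝟙 _)
  ... | s , sup = begin
    w                    ≤⟨ Equivalence.from sup (λ i → 𝟙-introʳ (h i)) ⟩
    hom s y              ≤⟨ 𝟙-elimʳ (∘-monoʳ _ x≼s) ⟩
    hom s y ∘ hom x s    ≤⟨ hom-trans x s y ⟩
    hom x y              ∎
    where
    open ≤-Reasoning
    x≼s : x ≼ s
    x≼s = least λ i → 𝟙-elimʳ (Equivalence.to sup (hom-refl s) i)

-- The dense families of fixed points

module _ {ℓ} {𝒬 : Quantaloid ℓ} {𝔸 𝔹 : QCat 𝒬} (φ : Dist 𝔸 𝔹) where
  open Arrows 𝒬
  open Presheaves {𝒬 = 𝒬}
  private
    module 𝔸 = QCat 𝔸
    module 𝔹 = QCat 𝔹
    module φ = Dist φ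

  -- Maps F and G as in the theorem, for a category 𝕏.
  Represents : QCat 𝒬 → Set (suc ℓ)
  Represents 𝕏 =
    Σ[ F ∈ TypedMap (_×dom 𝒬 𝔹.obj) (QCat.obj 𝕏) ]
    Σ[ G ∈ TypedMap (_×dom 𝒬 𝔸.obj) (QCat.obj 𝕏) ]
      (⋁-Dense 𝕏 F × ⋀-Dense 𝕏 G ×
       (∀ {p q r s} (a : 𝔸.Ob p) (u : Q₁ p q) (b : 𝔹.Ob r) (v : Q₁ r s) →
         (u ↙ φ.at a b) ↙ v
           ≈ QCat.hom 𝕏 (Func.to (F s) ⟨ b , v ⟩) (Func.to (G q) ⟨ a , u ⟩)))

  module FixedPoints where
    private
      module K = QCat (K φ)

    -- The presheaf b ↦ u ↙ φ(a,b).
    G₀ : ∀ {p q} → 𝔸.Ob p → Q₁ p q → Presheaf 𝔹 q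
    G₀ a u = presheaf 𝔹 (λ b → u ↙ φ.at a b) λ b b′ → curry $ assocˡ $
      L.trans (∘-monoʳ _ (φ.actˡ a b′ b)) (uncurry L.refl)

    G₀-closed : ∀ {p q} (a : 𝔸.Ob p) (u : Q₁ p q) → Closed φ (G₀ a u)
    G₀-closed a u = closed φ {ν = G₀ a u} λ y h → curry $ L.trans (h a) $
      proj₂ (⋁-isJoin _) λ _ → uncurry L.refl

    G₀-mono : ∀ {p q r} {a a′ : 𝔸.Ob p} {u u′ : Q₁ p q} →
              a 𝔸.Ob.≈ a′ → u ≈ u′ → (b : 𝔹.Ob r) → G₀ a u ⟦ b ⟧ ≤ G₀ a′ u′ ⟦ b ⟧
    G₀-mono {a = a} {a′} {u} {u′} e f b = curry $ begin
      (u ↙ φ.at a b) ∘ φ.at a′ b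
        ≤⟨ ∘-monoʳ _ (𝟙-elimʳ (∘-monoʳ _ (𝔸.hom-refl a))) ⟩
      (u ↙ φ.at a b) ∘ φ.at a′ b ∘ 𝔸.hom a a
        ≈⟨ ∘-cong L.Eq.refl (∘-cong L.Eq.refl (𝔸.hom-cong 𝔸.Ob.refl e)) ⟩
      (u ↙ φ.at a b) ∘ φ.at a′ b ∘ 𝔸.hom a a′
        ≤⟨ ∘-monoʳ _ (φ.actʳ a′ a b) ⟩
      (u ↙ φ.at a b) ∘ φ.at a b
        ≤⟨ uncurry L.refl ⟩
      u ≈⟨ f ⟩
      u′ ∎
      where open ≤-Reasoning

    G : TypedMap (_×dom 𝒬 𝔸.obj) K.obj
    G q = record
      { to   = λ { ⟨ a , u ⟩ → G₀ a u , G₀-closed a u }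
      ; cong = λ { (⟨_,_⟩ {a = a} {a′} {u} {u′} e f) →
          P-antisym {μ = G₀ a u} {G₀ a′ u′} (G₀-mono e f)
            (G₀-mono (𝔸.Ob.sym e) (L.Eq.sym f)) }
      }

    -- The closure of the representable presheaf of b weighted by v.
    F₀ : ∀ {p q} → 𝔹.Ob p → Q₁ p q → Presheaf 𝔹 q
    F₀ b v = closure φ (v ⊗y b)

    -- K φ(F(b,v),ν) = ν(b) ↙ v, stated through lower bounds: the closure adds
    -- nothing against a closed ν, and the Yoneda lemma applies.
    hom-F₀ : ∀ {p q r} {b : 𝔹.Ob p} {v : Q₁ p q} {ν : Presheaf 𝔹 r} →
             Closed φ ν → {w : Q₁ q r} →
             (w ≤ QCat.hom (P 𝔹) (F₀ b v) ν) ⇔ (w ∘ v ≤ ν ⟦ b ⟧)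
    hom-F₀ {b = b} {v} {ν} ν-closed {w} = mk⇔
      (λ h → L.trans
        (∘-monoʳ w (L.trans (⊗y-at {𝔸 = 𝔹} v b) (closure-extensive φ (v ⊗y b) b)))
        (hom-P-elim {μ = F₀ b v} {ν} h b))
      (λ h → hom-P-intro {μ = F₀ b v} {ν} λ y → L.trans
        (closure-mono φ {μ = v ⊗y b} {ν} (⊗y-least {v = v} {b} {ν} h) y)
        (L.reflexive (ν-closed y refl)))

    F₀-mono : ∀ {p q r} {b b′ : 𝔹.Ob p} {v v′ : Q₁ p q} →
              b 𝔹.Ob.≈ b′ → v ≈ v′ → (y : 𝔹.Ob r) → F₀ b v ⟦ y ⟧ ≤ F₀ b′ v′ ⟦ y ⟧
    F₀-mono {b = b} {b′} {v} {v′} e f y = 𝟙-elimˡ $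
      closure-mono φ {μ = v ⊗y b} {v′ ⊗y b′}
        (λ z → 𝟙-introˡ (L.reflexive (∘-cong f (𝔹.hom-cong 𝔹.Ob.refl e)))) y

    F : TypedMap (_×dom 𝒬 𝔹.obj) K.obj
    F q = record
      { to   = λ { ⟨ b , v ⟩ → F₀ b v , ⁎-closed φ ((φ ^*) (v ⊗y b)) }
      ; cong = λ { (⟨_,_⟩ {a = b} {b′} {v} {v′} e f) →
          P-antisym {μ = F₀ b v} {F₀ b′ v′} (F₀-mono e f)
            (F₀-mono (𝔹.Ob.sym e) (L.Eq.sym f)) }
      }

    F-⋁-dense : ⋁-Dense (K φ) F
    F-⋁-dense {q} (ν , ν-closed) =
        (Σ[ p ∈ Q₀ ] Σ[ b ∈ 𝔹.Ob p ] Σ[ v ∈ Q₁ p q ] v ≤ ν ⟦ b ⟧)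
      , (λ { (_ , b , v , _) → ⟨ b , v ⟩ })
      , (λ { (_ , b , v , v≤) →
          Equivalence.from (hom-F₀ {b = b} {v} {ν} ν-closed) (𝟙-introˡ v≤) })
      , λ { {κ , κ-closed} h → P-≼-intro {μ = ν} {κ} λ b → 𝟙-elimˡ $
          Equivalence.to (hom-F₀ {b = b} {ν ⟦ b ⟧} {κ} κ-closed)
            (h (_ , b , ν ⟦ b ⟧ , L.refl)) }

    G-⋀-dense : ⋀-Dense (K φ) G
    G-⋀-dense {q} (ν , ν-closed) =
        Σ Q₀ 𝔸.Ob
      , (λ { (_ , a) → ⟨ a , ((φ ^*) ν) ⟦ a ⟧ ⟩ })
      , (λ { (_ , a) → P-≼-intro {μ = ν} {G₀ a _} λ b →
          curry (^*-intro φ ν a b) })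
      , λ { {κ , _} h → P-≼-intro {μ = κ} {ν} λ b → L.trans
          (⁎-intro φ {μ = (φ ^*) ν} λ a → uncurry
            (P-≼-elim {μ = κ} {G₀ a _} (h (_ , a)) b))
          (L.reflexive (ν-closed b refl)) }

    K-represents : Represents (K φ)
    K-represents = F , G , F-⋁-dense , G-⋀-dense , λ a u b v → ≈-from-below $ mk⇔
      (λ h → Equivalence.from (hom-F₀ {b = b} {v} {G₀ a u} (G₀-closed a u)) (uncurry h))
      (λ h → curry (Equivalence.to (hom-F₀ {b = b} {v} {G₀ a u} (G₀-closed a u)) h))

  ≃⇒Represents : ∀ {𝕏} → 𝕏 ≃ K φ → Represents 𝕏
  ≃⇒Represents iso =
    let open Isomorphisms.Transport iso
        F , G , F-dense , G-dense , formula = FixedPoints.K-represents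
    in along F , along G , along-⋁-dense F F-dense , along-⋀-dense G G-dense
     , λ a u b v → L.Eq.trans (formula a u b v) (hom-inverse _ _)

-- From dense maps to an isomorphism with K φ

  module _ (𝕏 : QCat 𝒬) (separated : QCat.IsSeparated 𝕏) (complete : IsComplete 𝕏)
    where
    open Complete 𝕏 complete
    open Isomorphisms {𝒬 = 𝒬}
    private
      module 𝕏 = QCat 𝕏

    Represents⇒≃ : Represents 𝕏 → 𝕏 ≃ K φ
    Represents⇒≃ (F , G , F-dense , G-dense , formula) =
      ff-surjective⇒≃ toK separated full surjective
      where
      open ≤-Reasoning

      F[_,_] : ∀ {p q} → 𝔹.Ob p → Q₁ p q → 𝕏.Ob q
      F[ b , v ] = Func.to (F _) ⟨ b , v ⟩

      G[_,_] : ∀ {p q} → 𝔸.Ob p → Q₁ p q → 𝕏.Ob q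
      G[ a , u ] = Func.to (G _) ⟨ a , u ⟩

      hom-FG : ∀ {p q r s} {a : 𝔸.Ob p} {u : Q₁ p q} {b : 𝔹.Ob r} {v : Q₁ r s}
               {w : Q₁ s q} →
               (w ≤ 𝕏.hom F[ b , v ] G[ a , u ]) ⇔ ((w ∘ v) ∘ φ.at a b ≤ u)
      hom-FG {a = a} {u} {b} {v} = mk⇔
        (λ h → uncurry (uncurry
          (L.trans h (L.reflexive (L.Eq.sym (formula a u b v))))))
        (λ h → L.trans (curry (curry h)) (L.reflexive (formula a u b v)))

      -- The meet of objects G(a,u) that yields x.
      module Meet {q} (x : 𝕏.Ob q) where
        I : Set ℓ
        I = proj₁ (G-dense x)

        g : I → DomPair 𝒬 𝔸.obj q
        g = proj₁ (proj₂ (G-dense x))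

        a : ∀ i → 𝔸.Ob (DomPair.type (g i))
        a i = DomPair.elem (g i)

        u : ∀ i → Q₁ (DomPair.type (g i)) q
        u i = DomPair.arrow (g i)

        isMeet : IsMeet 𝕏._≼_ (λ i → G[ a i , u i ]) x
        isMeet = proj₂ (proj₂ (G-dense x))

      hom-F : ∀ {q r s} {x : 𝕏.Ob q} {b : 𝔹.Ob r} {v : Q₁ r s} {w : Q₁ s q} →
              let open Meet x in
              (w ≤ 𝕏.hom F[ b , v ] x) ⇔ (∀ i → (w ∘ v) ∘ φ.at (a i) b ≤ u i)
      hom-F {x = x} {b} {v} {w} = mk⇔
        (λ h i → Equivalence.to hom-FG $ begin
          w                                ≤⟨ h ⟩
          𝕏.hom F[ b , v ] x               ≤⟨ 𝟙-elimˡ (∘-monoˡ _ (proj₁ isMeet i)) ⟩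
          𝕏.hom x G[ a i , u i ] ∘ 𝕏.hom F[ b , v ] x
                                           ≤⟨ 𝕏.hom-trans _ _ _ ⟩
          𝕏.hom F[ b , v ] G[ a i , u i ]  ∎)
        (λ h → hom-meet isMeet λ i → Equivalence.from hom-FG (h i))
        where open Meet x

      -- The presheaf λ_x, whose value at b is 𝕏(F(b,1),x).
      L₀ : ∀ {q r} → 𝕏.Ob q → 𝔹.Ob r → Q₁ r q
      L₀ x b = 𝕏.hom F[ b , 𝟙 _ ] x

      ≤-L₀ : ∀ {q r} {x : 𝕏.Ob q} {b : 𝔹.Ob r} {w : Q₁ r q} →
             let open Meet x in
             (w ≤ L₀ x b) ⇔ (∀ i → w ∘ φ.at (a i) b ≤ u i)
      ≤-L₀ = mk⇔
        (λ h i → L.trans (∘-monoˡ _ (𝟙-elimʳ L.refl)) (Equivalence.to hom-F h i))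
        (λ h → Equivalence.from hom-F λ i →
          L.trans (∘-monoˡ _ (𝟙-introʳ L.refl)) (h i))

      -- 𝕏(F(b,v),x) = λ_x(b) ↙ v, stated through lower bounds.
      hom-F-L₀ : ∀ {q r s} {x : 𝕏.Ob q} {b : 𝔹.Ob r} {v : Q₁ r s} {w : Q₁ s q} →
                 (w ≤ 𝕏.hom F[ b , v ] x) ⇔ (w ∘ v ≤ L₀ x b)
      hom-F-L₀ = mk⇔
        (λ h → Equivalence.from ≤-L₀ (Equivalence.to hom-F h))
        (λ h → Equivalence.from hom-F (Equivalence.to ≤-L₀ h))

      L-presheaf : ∀ {q} → 𝕏.Ob q → Presheaf 𝔹 q
      L-presheaf x = presheaf 𝔹 (L₀ x) λ b b′ → Equivalence.from ≤-L₀ λ i →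
        assocˡ $ L.trans (∘-monoʳ _ (φ.actˡ _ b′ b)) (Equivalence.to ≤-L₀ L.refl i)

      L-closed : ∀ {q} (x : 𝕏.Ob q) → Closed φ (L-presheaf x)
      L-closed x = closed φ {ν = L-presheaf x} λ b h → Equivalence.from ≤-L₀ λ i →
        L.trans (h _) $ proj₂ (⋁-isJoin _) λ _ → Equivalence.to ≤-L₀ L.refl i

      L-hom : ∀ {p q} (x : 𝕏.Ob p) (y : 𝕏.Ob q) →
              𝕏.hom x y ≤ QCat.hom (P 𝔹) (L-presheaf x) (L-presheaf y)
      L-hom x y = hom-P-intro {μ = L-presheaf x} {L-presheaf y}
        λ b → 𝕏.hom-trans F[ b , 𝟙 _ ] x y

      L₀-mono : ∀ {q r} {x y : 𝕏.Ob q} → x 𝕏.≼ y → (b : 𝔹.Ob r) → L₀ x b ≤ L₀ y b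
      L₀-mono {x = x} {y} x≼y = P-≼-elim {μ = L-presheaf x} {L-presheaf y}
        (L.trans x≼y (L-hom x y))

      toK : QFunctor 𝕏 (K φ)
      toK = record
        { map   = λ q → record
            { to   = λ x → L-presheaf x , L-closed x
            ; cong = λ e → λ { b refl → 𝕏.hom-cong 𝕏.Ob.refl e }
            }
        ; hom-≤ = L-hom
        }

      full : ∀ {p q} (x : 𝕏.Ob p) (y : 𝕏.Ob q) →
             QCat.hom (P 𝔹) (L-presheaf x) (L-presheaf y) ≤ 𝕏.hom x y
      full x y with F-dense x
      ... | J , f , isJoin = hom-join isJoin λ j →
        Equivalence.from hom-F-L₀ $ L.trans
          -- Each F(b,v) in the join lies below x, which says v ≤ λ_x(b).
          (∘-monoʳ _ (𝟙-elimˡ (Equivalence.to hom-F-L₀ (proj₁ isJoin j))))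
          (hom-P-elim {μ = L-presheaf x} {L-presheaf y} L.refl _)

      -- The preimage of ν is the supremum of the F(b,1) weighted by the ν(b).
      surjective : ∀ {q} (ν : QCat.Ob (K φ) q) →
                   Σ[ x ∈ 𝕏.Ob q ] L-presheaf x ≈ᵈ proj₁ ν
      surjective {q} (ν , ν-closed)
        with weightedSup {I = Σ Q₀ 𝔹.Ob} (λ { (_ , b) → F[ b , 𝟙 _ ] })
                         (λ { (_ , b) → ν ⟦ b ⟧ })
      ... | x , sup = x , P-antisym {μ = L-presheaf x} {ν} below above
        where
        above : ∀ {r} (b : 𝔹.Ob r) → ν ⟦ b ⟧ ≤ L₀ x b
        above b = 𝟙-elimˡ (Equivalence.to sup (𝕏.hom-refl x) (_ , b))

        x≼G : ∀ {p} (a : 𝔸.Ob p) → x 𝕏.≼ G[ a , ((φ ^*) ν) ⟦ a ⟧ ]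
        x≼G a = Equivalence.from sup λ { (_ , b) → Equivalence.from hom-FG $
          L.trans (∘-monoˡ _ (𝟙-introʳ (𝟙-introˡ L.refl))) (^*-intro φ ν a b) }

        below : ∀ {r} (b : 𝔹.Ob r) → L₀ x b ≤ ν ⟦ b ⟧
        below b = L.trans
          (⁎-intro φ {μ = (φ ^*) ν} λ a →
            L.trans (∘-monoˡ _ (𝟙-elimʳ L.refl))
              (Equivalence.to hom-FG (L₀-mono (x≼G a) b)))
          (L.reflexive (ν-closed b refl))

theorem7p8 : {ℓ : Level} (𝒬 : Quantaloid ℓ) →
    let open Quantaloid 𝒬 in
    (𝔸 𝔹 : QCat 𝒬) (φ : Dist 𝔸 𝔹)
    (𝕏 : QCat 𝒬) → QCat.IsSeparated 𝕏 → IsComplete 𝕏 →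
    (𝕏 ≃ K φ) ⇔
    (Σ[ F ∈ TypedMap (_×dom 𝒬 (QCat.obj 𝔹)) (QCat.obj 𝕏) ]
    Σ[ G ∈ TypedMap (_×dom 𝒬 (QCat.obj 𝔸)) (QCat.obj 𝕏) ]
    (⋁-Dense 𝕏 F × ⋀-Dense 𝕏 G ×
    (∀ {p q r s} (a : QCat.Ob 𝔸 p) (u : Q₁ p q) (b : QCat.Ob 𝔹 r) (v : Q₁ r s) →
    (u ↙ Dist.at φ a b) ↙ v
    ≈ QCat.hom 𝕏 (Func.to (F s) ⟨ b , v ⟩) (Func.to (G q) ⟨ a , u ⟩))))
theorem7p8 𝒬 𝔸 𝔹 φ 𝕏 separated complete =
  mk⇔ (≃⇒Represents φ) (Represents⇒≃ φ 𝕏 separated complete)
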